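{- Let $\Lambda$ denote any one of the three families of Apostol-type polynomials of order $\alpha$: the Apostol-Bernoulli polynomials $\mathcal{B}_k^{(\alpha)}(x;\lambda)$, the Apostol-Euler polynomials $\mathcal{E}_k^{(\alpha)}(x;\lambda)$, or the Apostol-Genocchi polynomials $\mathcal{G}_k^{(\alpha)}(x;\lambda)$, where $\lambda$ is an arbitrary real or complex parameter and $\alpha$ is an order for which the chosen family is defined. Then for all integers $m\ge 0$, $n\ge 0$, all integers $p\geq 0$ and all $x,y$, the following holds. If $0\le p\le m+n$, then $$\sum_{k=0}^{n}\frac{(n+m-k)!}{(p-k)!}\binom{n}{k}y^k\Lambda_{p-k}^{(\alpha)}(x;\lambda)=\sum_{k=0}^{m}(-y)^k\frac{(n+m-k)!}{(p-k)!}\binom{m}{k}\Lambda_{p-k}^{(\alpha)}(x+y;\lambda).$$ If $p\ge m+n+1$, then $$\sum_{k=0}^{n}\frac{(n+m-k)!}{(p-k)!}\binom{n}{k}y^k\Lambda_{p-k}^{(\alpha)}(x;\lambda)=\sum_{k=0}^{m}(-y)^k\frac{(n+m-k)!}{(p-k)!}\binom{m}{k}\Lambda_{p-k}^{(\alpha)}(x+y;\lambda)-(-1)^m\frac{n!\,m!}{p!}\sum_{k=0}^{p-m-n-1}y^{p-k}\binom{p}{k}\binom{p-k-n-1}{m}\Lambda_k^{(\alpha)}(x;\lambda).$$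
   Context: The Apostol-Bernoulli, Apostol-Euler and Apostol-Genocchi polynomials of order $\alpha$ in the variable $x$ (real or complex) are defined by the generating functions (power series expansions in $t$ around $t=0$) $$\left(\frac{t}{\lambda e^t-1}\right)^{\alpha}e^{xt}=\sum_{k=0}^\infty \mathcal{B}_k^{(\alpha)}(x;\lambda)\frac{t^k}{k!},\qquad \left(\frac{2}{\lambda e^t+1}\right)^{\alpha}e^{xt}=\sum_{k=0}^\infty \mathcal{E}_k^{(\alpha)}(x;\lambda)\frac{t^k}{k!},\qquad \left(\frac{2t}{\lambda e^t+1}\right)^{\alpha}e^{xt}=\sum_{k=0}^\infty \mathcal{G}_k^{(\alpha)}(x;\lambda)\frac{t^k}{k!}.$$ Here $1^\alpha:=1$, and the $\alpha$-th power is taken with a fixed branch analytic near $t=0$. The range of parameters is: for $\mathcal{B}$, $\alpha\in\mathbb{C}$ if $\lambda=1$, and $\alpha$ a nonnegative integer if $\lambda\neq 1$; for $\mathcal{E}$, $\alpha\in\mathbb{C}$ and $\lambda\ne -1$; for $\mathcal{G}$, $\alpha\in\mathbb{C}$ if $\lambda=-1$, and $\alpha$ a nonnegative integer if $\lambda\ne -1$. Convention: $\Lambda_k^{(\alpha)}(x;\lambda)=0$ for $k\le -1$, and any term containing such a polynomial (including the accompanying $1/(p-k)!$ with $p-k<0$) is zero. -}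

module Defs where

open import Algebra.Apartness.Bundles using (HeytingField; HeytingCommutativeRing)
open import Algebra.Bundles using (CommutativeRing; Semiring)
open import Data.Fin.Base using (toℕ)
open import Data.Integer.Base using (ℤ; +_; -[1+_])
open import Data.Nat.Base as ℕ using (ℕ; zero; suc; _∸_; _!; NonZero)
open import Data.Nat.Properties using (_!≢0)
open import Data.Product.Base using (_,_; proj₁)
open import Level using (_⊔_) renaming (suc to lsuc)
import Algebra.Definitions.RawSemiring as RawSemiringDefs
import Algebra.Properties.Ring as RingProperties
import Relation.Binary.Reasoning.Setoid as SetoidReasoning

-- A field of characteristic zero with a homomorphism `exp` from its additive
-- group to its multiplicative group.  The complex numbers with the complex
-- exponential are the intended instance; they are not available in the
-- library, and complex powers c^α = exp (α log c) need nothing more.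
record ExponentialField c ℓ₁ ℓ₂ : Set (lsuc (c ⊔ ℓ₁ ⊔ ℓ₂)) where
  field
    heytingField : HeytingField c ℓ₁ ℓ₂

  open HeytingField heytingField public

  commutativeRing : CommutativeRing c ℓ₁
  commutativeRing = HeytingCommutativeRing.commutativeRing heytingCommutativeRing

  open RawSemiringDefs (Semiring.rawSemiring (CommutativeRing.semiring commutativeRing)) public
    using (_×_; _^_; sum)

  field
    characteristic-zero : ∀ n → suc n × 1# # 0#
    exp      : Carrier → Carrier
    exp-cong : ∀ {x y} → x ≈ y → exp x ≈ exp y
    exp-0    : exp 0# ≈ 1#
    exp-+    : ∀ x y → exp (x + y) ≈ exp x * exp y

data Family : Set where
  bernoulli euler genocchi : Family

module Apostol {c ℓ₁ ℓ₂} (K : ExponentialField c ℓ₁ ℓ₂) where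

  open ExponentialField K public
    using (Carrier; _≈_; _#_; _+_; _*_; -_; _-_; 0#; 1#; _×_; _^_; exp)
  open ExponentialField K
    using (commutativeRing; sum; characteristic-zero;
           #⇒invertible; invertible⇒#; refl; sym; trans; setoid;
           +-cong; +-congˡ; +-congʳ; +-identityˡ; +-identityʳ;
           *-cong; *-congˡ; *-congʳ; *-identityˡ; *-identityʳ)
  open RingProperties (CommutativeRing.ring commutativeRing)
    using (-‿involutive; -0#≈0#)

  ι : ℕ → Carrier
  ι n = n × 1#

  inverse : ∀ {x} → x # 0# → Carrier
  inverse x#0 = proj₁ (#⇒invertible x#0)

  1/ : ∀ n .{{_ : NonZero n}} → Carrier
  1/ (suc n) = inverse (characteristic-zero n)

  invFact : ℕ → Carrier
  invFact n = 1/ (n !) {{n !≢0}}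

  -- Extended by zero to negative arguments.
  invFactℤ : ℤ → Carrier
  invFactℤ (+ n)    = invFact n
  invFactℤ -[1+ _ ] = 0#

  -- Both bounds are inclusive: k runs over 0, …, n.
  ∑≤ : ℕ → (ℕ → Carrier) → Carrier
  ∑≤ n f = sum {suc n} (λ i → f (toℕ i))

  syntax ∑≤ n (λ k → e) = ∑[ k ≤ n ] e

  -- Formal power series in t, as sequences of coefficients.
  Series : Set c
  Series = ℕ → Carrier

  infixl 6 _⊕_ _⊝_
  infixl 7 _⊛_ _∙_
  infixr 8 _^ˢ_

  const : Carrier → Series
  const a zero    = a
  const a (suc _) = 0#

  𝕥 : Series
  𝕥 (suc zero) = 1#
  𝕥 _          = 0#

  _⊕_ _⊝_ _⊛_ : Series → Series → Series
  (f ⊕ g) n = f n + g n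
  (f ⊝ g) n = f n - g n
  (f ⊛ g) n = ∑[ k ≤ n ] (f k * g (n ∸ k))

  _∙_ : Carrier → Series → Series
  (a ∙ f) n = a * f n

  _^ˢ_ : Series → ℕ → Series
  f ^ˢ zero  = const 1#
  f ^ˢ suc n = f ⊛ f ^ˢ n

  -- f / t, for f without constant term.
  _/𝕥 : Series → Series
  (f /𝕥) n = f (suc n)

  -- ∑ⱼ aⱼ uʲ, for u without constant term: then uʲ contributes to the
  -- coefficient of tⁿ only when j ≤ n.
  compose : (ℕ → Carrier) → Series → Series
  compose a u n = ∑[ j ≤ n ] (a j * (u ^ˢ j) n)

  -- 1 / f as the geometric series c⁻¹ ∑ⱼ (1 - c⁻¹ f)ʲ with c = f 0.
  reciprocal : (f : Series) → f 0 # 0# → Series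
  reciprocal f f₀#0 = c⁻¹ ∙ compose (λ _ → 1#) (const 1# ⊝ c⁻¹ ∙ f)
    where c⁻¹ = inverse f₀#0

  e^[_t] : Carrier → Series
  (e^[ x t]) n = x ^ n * invFact n

  -- exp f = exp (f 0) ∑ⱼ (f - f 0)ʲ / j!
  expˢ : Series → Series
  expˢ f = exp (f 0) ∙ compose invFact (f ⊝ const (f 0))

  -- A branch of log f near t = 0 is determined by its value at t = 0; the
  -- last field is the convention 1^α = 1.
  record Branch (f : Series) : Set (c ⊔ ℓ₁) where
    field
      log₀     : Carrier
      exp-log₀ : exp log₀ ≈ f 0
      log₀-1   : f 0 ≈ 1# → log₀ ≈ 0#

  -- log₀ + ∑_{j≥1} (-1)^{j-1} (f / f 0 - 1)ʲ / j, with (f 0)⁻¹ = exp (- log₀).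
  logˢ : (f : Series) → Branch f → Series
  logˢ f b = const log₀ ⊕ compose coeff (exp (- log₀) ∙ f ⊝ const 1#)
    where
    open Branch b
    coeff : ℕ → Carrier
    coeff zero    = 0#
    coeff (suc j) = (- 1#) ^ j * 1/ (suc j)

  power : (f : Series) → Branch f → Carrier → Series
  power f b α = expˢ (α ∙ logˢ f b)

  den⁻ den⁺ : Carrier → Series
  den⁻ ƛ = ƛ ∙ e^[ 1# t] ⊝ const 1#
  den⁺ ƛ = ƛ ∙ e^[ 1# t] ⊕ const 1#

  private
    open SetoidReasoning setoid

    #-transport : ∀ {x y z} → x # y → x - y ≈ z → z # 0#
    #-transport {z = z} x#y x-y≈z with #⇒invertible x#y
    ... | w , wl , wr = invertible⇒# (w , trans (*-congˡ z-0≈) wl , trans (*-congʳ z-0≈) wr)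
      where
      z-0≈ : z - 0# ≈ _
      z-0≈ = trans (trans (+-congˡ -0#≈0#) (+-identityʳ z)) (sym x-y≈z)

    inverse-1 : ∀ (q : 1 × 1# # 0#) → inverse q ≈ 1#
    inverse-1 q with #⇒invertible q
    ... | w , wl , _ = begin
      w                    ≈⟨ *-identityʳ w ⟨
      w * 1#               ≈⟨ *-congˡ one ⟨
      w * (1 × 1# - 0#)    ≈⟨ wl ⟩
      1#                   ∎
      where
      one : 1 × 1# - 0# ≈ 1#
      one = trans (+-cong (+-identityʳ 1#) -0#≈0#) (+-identityʳ 1#)

    e₀ : ∀ ƛ → ƛ ≈ (ƛ ∙ e^[ 1# t]) 0
    e₀ ƛ = sym (trans (*-congˡ (trans (*-identityˡ _) (inverse-1 _))) (*-identityʳ ƛ))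

    e₁ : ∀ ƛ → ƛ ≈ (ƛ ∙ e^[ 1# t]) 1
    e₁ ƛ = sym (trans (*-congˡ (trans (*-cong (*-identityʳ 1#) (inverse-1 _)) (*-identityʳ 1#)))
                      (*-identityʳ ƛ))

    ∓0 : ∀ {x} → x ≈ x - 0#
    ∓0 {x} = sym (trans (+-congˡ -0#≈0#) (+-identityʳ x))

    1#0 : 1# # 0#
    1#0 = #-transport (characteristic-zero 0) (trans (sym ∓0) (+-identityʳ 1#))

    -1#0 : - 1# # 0#
    -1#0 = #-transport (ExponentialField.#-sym K 1#0) (+-identityˡ (- 1#))

  den⁻-unit : ∀ {ƛ} → ƛ # 1# → den⁻ ƛ 0 # 0#
  den⁻-unit ƛ#1 = #-transport ƛ#1 (+-congʳ (e₀ _))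

  den⁺-unit : ∀ {ƛ} → ƛ # - 1# → den⁺ ƛ 0 # 0#
  den⁺-unit ƛ#-1 = #-transport ƛ#-1 (+-cong (e₀ _) (-‿involutive 1#))

  den⁻/𝕥-unit : ∀ {ƛ} → ƛ ≈ 1# → (den⁻ ƛ /𝕥) 0 # 0#
  den⁻/𝕥-unit ƛ≈1 =
    #-transport 1#0 (trans (sym ∓0) (trans (sym ƛ≈1) (trans (e₁ _) ∓0)))

  den⁺/𝕥-unit : ∀ {ƛ} → ƛ ≈ - 1# → (den⁺ ƛ /𝕥) 0 # 0#
  den⁺/𝕥-unit ƛ≈-1 =
    #-transport -1#0 (trans (sym ∓0) (trans (sym ƛ≈-1) (trans (e₁ _) (sym (+-identityʳ _)))))

  -- The bases of the α-th powers.  When λ is the exceptional value the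
  -- denominator has no constant term, and t is cancelled first.
  bernoulliBase : ∀ ƛ → ƛ # 1# → Series
  bernoulliBase ƛ ƛ#1 = 𝕥 ⊛ reciprocal (den⁻ ƛ) (den⁻-unit ƛ#1)

  bernoulliBase₁ : ∀ ƛ → ƛ ≈ 1# → Series
  bernoulliBase₁ ƛ ƛ≈1 = reciprocal (den⁻ ƛ /𝕥) (den⁻/𝕥-unit ƛ≈1)

  eulerBase : ∀ ƛ → ƛ # - 1# → Series
  eulerBase ƛ ƛ#-1 = ι 2 ∙ reciprocal (den⁺ ƛ) (den⁺-unit ƛ#-1)

  genocchiBase : ∀ ƛ → ƛ # - 1# → Series
  genocchiBase ƛ ƛ#-1 = ι 2 ∙ 𝕥 ⊛ reciprocal (den⁺ ƛ) (den⁺-unit ƛ#-1)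

  genocchiBase₋₁ : ∀ ƛ → ƛ ≈ - 1# → Series
  genocchiBase₋₁ ƛ ƛ≈-1 = ι 2 ∙ reciprocal (den⁺ ƛ /𝕥) (den⁺/𝕥-unit ƛ≈-1)

  -- The orders α for which a family with parameter λ is defined, each with
  -- the branch used when α is an arbitrary scalar.
  data Order : Family → Carrier → Set (c ⊔ ℓ₁ ⊔ ℓ₂) where
    bernoulli-λ=1  : ∀ {ƛ} (p : ƛ ≈ 1#) (α : Carrier) →
                     Branch (bernoulliBase₁ ƛ p) → Order bernoulli ƛ
    bernoulli-λ≠1  : ∀ {ƛ} (p : ƛ # 1#) (α : ℕ) → Order bernoulli ƛ
    euler-λ≠-1     : ∀ {ƛ} (p : ƛ # - 1#) (α : Carrier) →
                     Branch (eulerBase ƛ p) → Order euler ƛ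
    genocchi-λ=-1  : ∀ {ƛ} (p : ƛ ≈ - 1#) (α : Carrier) →
                     Branch (genocchiBase₋₁ ƛ p) → Order genocchi ƛ
    genocchi-λ≠-1  : ∀ {ƛ} (p : ƛ # - 1#) (α : ℕ) → Order genocchi ƛ

  prefactor : ∀ {F ƛ} → Order F ƛ → Series
  prefactor (bernoulli-λ=1 p α b) = power (bernoulliBase₁ _ p) b α
  prefactor (bernoulli-λ≠1 p α)   = bernoulliBase _ p ^ˢ α
  prefactor (euler-λ≠-1 p α b)    = power (eulerBase _ p) b α
  prefactor (genocchi-λ=-1 p α b) = power (genocchiBase₋₁ _ p) b α
  prefactor (genocchi-λ≠-1 p α)   = genocchiBase _ p ^ˢ α

  generatingFunction : ∀ {F ƛ} → Order F ƛ → Carrier → Series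
  generatingFunction α x = prefactor α ⊛ e^[ x t]

  -- The k-th polynomial of family F, order α and parameter λ
  -- evaluated at x, and 0 for negative k.
  Λ : ∀ F {ƛ} → Order F ƛ → ℤ → Carrier → Carrier
  Λ F α (+ k)    x = ι (k !) * generatingFunction α x k
  Λ F α -[1+ _ ] x = 0#

module Submission where

-- Write f for the generating function of the polynomials at x, so that
-- Λₖ(x) / k! is the coefficient fₖ of tᵏ.  The only property of f that
-- matters is that passing from x to x + y multiplies it by e^{yt}
-- (`generatingFunction-+`).  Hence the sum on the left is the coefficient of
-- tᵖ in A f, and the sum over k ≤ m on the right is that of B e^{yt} f, where
--
--   Aₖ = (n + m - k)! (n choose k) yᵏ,   Bₖ = (n + m - k)! (m choose k) (-y)ᵏ.
--
-- The theorem becomes an identity of series, B e^{yt} = A + D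
-- (`right-shifted`), with
--
--   Dⱼ = (-1)ᵐ n! m! (j - n - 1 choose m) yʲ / j!   for j > n,
--
-- and Dⱼ = 0 for j ≤ n.  Since the binomial coefficient vanishes also for
-- n < j ≤ m + n, the coefficient of tᵖ in D f is zero when p ≤ m + n
-- (`correctionSum-small`), and it is the additional sum of the theorem when
-- p > m + n (`correctionSum-large`).
--
-- Put ω m n k = (n + m - k)! (m choose k) k!.  After division by yʲ / j! the
-- identity of series reads (`transform-ω`)
--
--   ∑_{k ≤ j} (j choose k) (-1)ᵏ ω m n k
--     = ω n m j + (-1)ᵐ n! m! (j - n - 1 choose m) [j > n].
--
-- It is proved by induction on m and j.  As ω (m+1) n (k+1) = (m+1) ω m n k,
-- Pascal's rule turns the left side L into L(m+1, j+1) = L(m+1, j) - (m+1) L(m, j),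
-- and both terms of the right side satisfy the same recurrence
-- (`ω-pascal`, `excess-pascal`).

open import Defs
open import Data.Nat.Base as ℕ using (ℕ; _∸_; _≤_; _!)
open import Data.Nat.Combinatorics using (_C_)
open import Data.Integer.Base using (+_; _⊖_)
open import Data.Product.Base using () renaming (_×_ to _∧_)

open import Algebra.Bundles using (CommutativeRing)
open import Data.Fin.Base using (toℕ)
open import Data.Fin.Properties using (toℕ≤pred[n])
open import Data.Integer.Base using (ℤ; -[1+_])
open import Data.Integer.Properties using ([1+m]⊖[1+n]≡m⊖n)
open import Data.Nat.Base using (zero; suc; _<_; z≤n; s≤s; NonZero; _≤′_; ≤′-refl; ≤′-step)
open import Data.Nat.Combinatorics
  using (k>n⇒nCk≡0; nCk≡n!/k![n-k]!; k![n∸k]!∣n!; nCk+nC[k+1]≡[n+1]C[k+1])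
open import Data.Nat.DivMod using (m/n*n≡m)
open import Data.Nat.Properties as ℕₚ using (_!≢0; _!*_!≢0)
open import Data.Nat.Tactic.RingSolver using (solve-∀)
open import Data.Product.Base using (_,_; proj₂)
open import Data.Sum.Base using (inj₁; inj₂)
open import Relation.Binary.PropositionalEquality as ≡ using (_≡_)
import Algebra.Properties.CommutativeSemiring.Binomial as Binomial
import Algebra.Properties.CommutativeSemiring.Exp as Exp
import Algebra.Properties.Ring as RingProperties
import Algebra.Properties.Semiring.Mult as Mult
import Algebra.Properties.Semiring.Sum as Sum
import Algebra.Solver.Ring.NaturalCoefficients.Default as SemiringSolver
import Relation.Binary.Reasoning.Setoid as SetoidReasoning

-- Binomial coefficients and the two terms of the alternating sum

nCk*k!*[n∸k]!≡n! : ∀ {n k} → k ≤ n → (n C k) ℕ.* (k ! ℕ.* (n ∸ k) !) ≡ n !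
nCk*k!*[n∸k]!≡n! {n} {k} k≤n =
  ≡.trans (≡.cong (ℕ._* (k ! ℕ.* (n ∸ k) !)) (nCk≡n!/k![n-k]! k≤n))
          (m/n*n≡m (k![n∸k]!∣n! k≤n))
  where instance _ = k !* (n ∸ k) !≢0

-- In terms of the falling factorial (n)ₖ = (n choose k) k!, this is
-- (n + 1)ₖ₊₁ = (n + 1) (n)ₖ.
falling-suc : ∀ n k → (suc n C suc k) ℕ.* suc k ! ≡ suc n ℕ.* ((n C k) ℕ.* k !)
falling-suc n k with ℕₚ.≤-<-connex k n
... | inj₁ k≤n = ℕₚ.*-cancelʳ-≡ _ _ ((n ∸ k) !) {{(n ∸ k) !≢0}} (begin
  (suc n C suc k) ℕ.* suc k ! ℕ.* (n ∸ k) !     ≡⟨ ℕₚ.*-assoc (suc n C suc k) _ _ ⟩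
  (suc n C suc k) ℕ.* (suc k ! ℕ.* (n ∸ k) !)   ≡⟨ nCk*k!*[n∸k]!≡n! (s≤s k≤n) ⟩
  suc n ℕ.* n !                                 ≡⟨ ≡.cong (suc n ℕ.*_) (nCk*k!*[n∸k]!≡n! k≤n) ⟨
  suc n ℕ.* ((n C k) ℕ.* (k ! ℕ.* (n ∸ k) !))   ≡⟨ rearrange (suc n) (n C k) (k !) _ ⟩
  suc n ℕ.* ((n C k) ℕ.* k !) ℕ.* (n ∸ k) !     ∎)
  where
  open ≡.≡-Reasoning
  rearrange : ∀ a b c d → a ℕ.* (b ℕ.* (c ℕ.* d)) ≡ a ℕ.* (b ℕ.* c) ℕ.* d
  rearrange = solve-∀
... | inj₂ n<k
  rewrite k>n⇒nCk≡0 (s≤s n<k) | k>n⇒nCk≡0 n<k = ≡.sym (ℕₚ.*-zeroʳ n)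

-- The number (n + m - k)! (m choose k) k!, which is 0 for k > m.  The recursive
-- definition makes the step k ↦ k + 1 computational; `ω-closed` recovers the
-- closed form.
ω : ℕ → ℕ → ℕ → ℕ
ω m       n zero    = (n ℕ.+ m) !
ω zero    n (suc k) = 0
ω (suc m) n (suc k) = suc m ℕ.* ω m n k

ω-closed : ∀ m n k → ω m n k ≡ (n ℕ.+ m ∸ k) ! ℕ.* ((m C k) ℕ.* k !)
ω-closed m       n zero    = ≡.sym (ℕₚ.*-identityʳ _)
ω-closed zero    n (suc k) = ≡.sym (ℕₚ.*-zeroʳ ((n ℕ.+ 0 ∸ suc k) !))
ω-closed (suc m) n (suc k) = begin
  suc m ℕ.* ω m n k
    ≡⟨ ≡.cong (suc m ℕ.*_) (ω-closed m n k) ⟩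
  suc m ℕ.* ((n ℕ.+ m ∸ k) ! ℕ.* ((m C k) ℕ.* k !))
    ≡⟨ swap (suc m) ((n ℕ.+ m ∸ k) !) ((m C k) ℕ.* k !) ⟩
  (n ℕ.+ m ∸ k) ! ℕ.* (suc m ℕ.* ((m C k) ℕ.* k !))
    ≡⟨ ≡.cong₂ (λ a b → (a ∸ suc k) ! ℕ.* b) (ℕₚ.+-suc n m) (falling-suc m k) ⟨
  (n ℕ.+ suc m ∸ suc k) ! ℕ.* ((suc m C suc k) ℕ.* suc k !) ∎
  where
  open ≡.≡-Reasoning
  swap : ∀ a b c → a ℕ.* (b ℕ.* c) ≡ b ℕ.* (a ℕ.* c)
  swap = solve-∀

ω-pascal : ∀ n m j → ω n (suc m) j ≡ ω n (suc m) (suc j) ℕ.+ suc m ℕ.* ω n m j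
ω-pascal zero    m zero    rewrite ℕₚ.+-identityʳ m = ≡.refl
ω-pascal zero    m (suc j) = ≡.sym (ℕₚ.*-zeroʳ m)
ω-pascal (suc n) m zero    rewrite ℕₚ.+-suc m n =
  split n m ((m ℕ.+ n) !)
  where
  split : ∀ n m f → suc (suc (m ℕ.+ n)) ℕ.* (suc (m ℕ.+ n) ℕ.* f) ≡
          suc n ℕ.* (suc (m ℕ.+ n) ℕ.* f) ℕ.+ suc m ℕ.* (suc (m ℕ.+ n) ℕ.* f)
  split = solve-∀
ω-pascal (suc n) m (suc j) rewrite ω-pascal n m j =
  expand (suc n) (suc m) (ω n (suc m) (suc j)) (ω n m j)
  where
  expand : ∀ a b c d → a ℕ.* (c ℕ.+ b ℕ.* d) ≡ a ℕ.* c ℕ.+ b ℕ.* (a ℕ.* d)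
  expand = solve-∀

-- The binomial coefficient (j - n - 1 choose m), taken to be 0 when j ≤ n, even
-- for m = 0.
excess : ℕ → ℕ → ℕ → ℕ
excess n       m zero    = 0
excess zero    m (suc j) = j C m
excess (suc n) m (suc j) = excess n m j

excess-pascal : ∀ n m j → excess n (suc m) (suc j) ≡ excess n (suc m) j ℕ.+ excess n m j
excess-pascal zero    m zero    = ≡.refl
excess-pascal zero    m (suc j) =
  ≡.trans (≡.sym (nCk+nC[k+1]≡[n+1]C[k+1] j m)) (ℕₚ.+-comm (j C m) _)
excess-pascal (suc n) m zero    = ≡.refl
excess-pascal (suc n) m (suc j) = excess-pascal n m j

excess-small : ∀ n m {j} → j ≤ m ℕ.+ n → excess n m j ≡ 0
excess-small n       m {zero}  j≤m+n = ≡.refl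
excess-small zero    m {suc j} j<m+0 = k>n⇒nCk≡0 (≡.subst (j <_) (ℕₚ.+-identityʳ m) j<m+0)
excess-small (suc n) m {suc j} j<m+n =
  excess-small n m (ℕₚ.≤-pred (≡.subst (suc j ≤_) (ℕₚ.+-suc m n) j<m+n))

excess-large : ∀ n m {j} → n < j → excess n m j ≡ (j ∸ n ∸ 1) C m
excess-large zero    m {suc j} _         = ≡.refl
excess-large (suc n) m {suc j} (s≤s n<j) = excess-large n m n<j

-- The two summands are complementary: the first is n! for j ≤ n and 0 otherwise,
-- the second is n! for j > n and 0 otherwise.
ω-excess-0 : ∀ n j → ω n 0 j ℕ.+ n ! ℕ.* excess n 0 j ≡ n !
ω-excess-0 n       zero    = ≡.trans (≡.cong (n ! ℕ.+_) (ℕₚ.*-zeroʳ (n !))) (ℕₚ.+-identityʳ _)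
ω-excess-0 zero    (suc j) = ≡.refl
ω-excess-0 (suc n) (suc j) = ≡.trans
  (factor (suc n) (ω n 0 j) (n !) (excess n 0 j)) (≡.cong (suc n ℕ.*_) (ω-excess-0 n j))
  where
  factor : ∀ a b c d → a ℕ.* b ℕ.+ a ℕ.* c ℕ.* d ≡ a ℕ.* (b ℕ.+ c ℕ.* d)
  factor = solve-∀

-- The range k ≤ p - m - n - 1 of the additional sum, for truncated subtraction

∸-gather : ∀ p m n → p ∸ m ∸ n ∸ 1 ≡ p ∸ (m ℕ.+ n ℕ.+ 1)
∸-gather p m n = ≡.trans (≡.cong (_∸ 1) (ℕₚ.∸-+-assoc p m n)) (ℕₚ.∸-+-assoc p (m ℕ.+ n) 1)

gap-small : ∀ p m n {k} → p ∸ m ∸ n ∸ 1 < k → p ∸ k ≤ m ℕ.+ n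
gap-small p m n {k} q<k rewrite ∸-gather p m n = ℕₚ.m≤n+o⇒m∸n≤o p k (begin
  p                                ≤⟨ ℕₚ.m≤n+m∸n p (m ℕ.+ n ℕ.+ 1) ⟩
  m ℕ.+ n ℕ.+ 1 ℕ.+ q              ≡⟨ rotate (m ℕ.+ n) q ⟩
  suc q ℕ.+ (m ℕ.+ n)              ≤⟨ ℕₚ.+-monoˡ-≤ (m ℕ.+ n) q<k ⟩
  k ℕ.+ (m ℕ.+ n)                  ∎)
  where
  open ℕₚ.≤-Reasoning
  q = p ∸ (m ℕ.+ n ℕ.+ 1)
  rotate : ∀ a b → a ℕ.+ 1 ℕ.+ b ≡ suc b ℕ.+ a
  rotate = solve-∀

gap-large : ∀ p m n {k} → m ℕ.+ n ℕ.+ 1 ≤ p → k ≤ p ∸ m ∸ n ∸ 1 → n < p ∸ k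
gap-large p m n {k} m+n<p k≤q rewrite ∸-gather p m n = ℕₚ.m+n≤o⇒m≤o∸n (suc n) (begin
  suc n ℕ.+ k                      ≤⟨ ℕₚ.+-mono-≤ (s≤s (ℕₚ.m≤n+m n m)) k≤q ⟩
  suc (m ℕ.+ n) ℕ.+ q              ≡⟨ ≡.cong (ℕ._+ q) (ℕₚ.+-comm 1 (m ℕ.+ n)) ⟩
  m ℕ.+ n ℕ.+ 1 ℕ.+ q              ≡⟨ ℕₚ.m+[n∸m]≡n m+n<p ⟩
  p                                ∎)
  where
  open ℕₚ.≤-Reasoning
  q = p ∸ (m ℕ.+ n ℕ.+ 1)

module _ {c ℓ₁ ℓ₂} (K : ExponentialField c ℓ₁ ℓ₂) where
  open Apostol K
  open ExponentialField K
    using (commutativeRing; #⇒invertible; characteristic-zero; setoid;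
           refl; sym; trans; +-cong; +-congˡ; +-congʳ; +-identityʳ; +-assoc; +-comm;
           *-cong; *-congˡ; *-congʳ; *-identityˡ; *-identityʳ; *-assoc; *-comm;
           zeroˡ; zeroʳ; distribʳ; -‿inverseʳ)
  open CommutativeRing commutativeRing using (semiring; commutativeSemiring; ring; reflexive)
  open RingProperties ring using (-1*x≈-x; -0#≈0#)
  open Mult semiring using (×-homo-+; ×1-homo-*; ×-assoc-*; ×-congʳ)
  open Sum semiring using (sum-cong-≋; *-distribˡ-sum; ∑-distrib-+)
  open Exp commutativeSemiring using (^-distrib-*; ^-congˡ; ^-homo-*)
  open SemiringSolver commutativeSemiring using (solve; _:=_; _:+_; _:*_; con)
  open SetoidReasoning setoid

  -- Factorials in the field

  infix 4 _≋_
  _≋_ : Series → Series → Set ℓ₁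
  f ≋ g = ∀ n → f n ≈ g n

  ι-cong : ∀ {a b} → a ≡ b → ι a ≈ ι b
  ι-cong ≡.refl = refl

  ι-* : ∀ a b → ι (a ℕ.* b) ≈ ι a * ι b
  ι-* = ×1-homo-*

  ι-+ : ∀ a b → ι (a ℕ.+ b) ≈ ι a + ι b
  ι-+ = ×-homo-+ 1#

  ι*1/ : ∀ n .{{_ : NonZero n}} → ι n * 1/ n ≈ 1#
  ι*1/ (suc n) = trans (*-congʳ (sym ι-0≈ι)) (proj₂ (proj₂ (#⇒invertible (characteristic-zero n))))
    where
    ι-0≈ι : ι (suc n) - 0# ≈ ι (suc n)
    ι-0≈ι = trans (+-congˡ -0#≈0#) (+-identityʳ _)

  !*invFact : ∀ n → ι (n !) * invFact n ≈ 1#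
  !*invFact n = ι*1/ (n !) {{n !≢0}}

  invFact-binomial : ∀ {n k} → k ≤ n → invFact k * invFact (n ∸ k) ≈ invFact n * ι (n C k)
  invFact-binomial {n} {k} k≤n = begin
    a * b
      ≈⟨ *-identityʳ _ ⟨
    a * b * 1#
      ≈⟨ *-congˡ (!*invFact n) ⟨
    a * b * (ι (n !) * f)
      ≈⟨ *-congˡ (*-congʳ n!≈) ⟩
    a * b * (ι (n C k) * (ι (k !) * ι ((n ∸ k) !)) * f)
      ≈⟨ solve 6 (λ a b c k! l! f →
           a :* b :* (c :* (k! :* l!) :* f) := (f :* c) :* ((k! :* a) :* (l! :* b)))
           refl a b (ι (n C k)) (ι (k !)) (ι ((n ∸ k) !)) f ⟩
    f * ι (n C k) * ((ι (k !) * a) * (ι ((n ∸ k) !) * b))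
      ≈⟨ *-congˡ (trans (*-cong (!*invFact k) (!*invFact (n ∸ k))) (*-identityʳ 1#)) ⟩
    f * ι (n C k) * 1#
      ≈⟨ *-identityʳ _ ⟩
    f * ι (n C k) ∎
    where
    a = invFact k
    b = invFact (n ∸ k)
    f = invFact n
    n!≈ : ι (n !) ≈ ι (n C k) * (ι (k !) * ι ((n ∸ k) !))
    n!≈ = trans (ι-cong (≡.sym (nCk*k!*[n∸k]!≡n! k≤n)))
                (trans (ι-* (n C k) _) (*-congˡ (ι-* (k !) _)))

  -- Finite sums

  ∑-cong : ∀ n {f g : ℕ → Carrier} → (∀ k → k ≤ n → f k ≈ g k) → ∑≤ n f ≈ ∑≤ n g
  ∑-cong n f≈g = sum-cong-≋ {suc n} (λ i → f≈g (toℕ i) (toℕ≤pred[n] i))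

  ∑-zero : ∀ n {f : ℕ → Carrier} → (∀ k → k ≤ n → f k ≈ 0#) → ∑≤ n f ≈ 0#
  ∑-zero zero    f≈0 = trans (+-identityʳ _) (f≈0 0 z≤n)
  ∑-zero (suc n) f≈0 =
    trans (+-cong (f≈0 0 z≤n) (∑-zero n (λ k k≤n → f≈0 (suc k) (s≤s k≤n)))) (+-identityʳ 0#)

  ∑-+ : ∀ n (f g : ℕ → Carrier) → ∑[ k ≤ n ] (f k + g k) ≈ ∑≤ n f + ∑≤ n g
  ∑-+ n f g = ∑-distrib-+ {suc n} (λ i → f (toℕ i)) (λ i → g (toℕ i))

  *-∑ : ∀ n a (f : ℕ → Carrier) → a * ∑≤ n f ≈ ∑[ k ≤ n ] (a * f k)
  *-∑ n a f = *-distribˡ-sum {suc n} a (λ i → f (toℕ i))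

  ∑-last : ∀ n (f : ℕ → Carrier) → ∑≤ (suc n) f ≈ ∑≤ n f + f (suc n)
  ∑-last zero    f = trans (sym (+-assoc _ _ _)) (trans (+-identityʳ _) (+-congʳ (sym (+-identityʳ _))))
  ∑-last (suc n) f = trans (+-congˡ (∑-last n (λ k → f (suc k)))) (sym (+-assoc _ _ _))

  ∑-truncate : ∀ {n N} {f : ℕ → Carrier} → n ≤ N → (∀ k → n < k → k ≤ N → f k ≈ 0#) →
               ∑≤ N f ≈ ∑≤ n f
  ∑-truncate {n} {N} {f} n≤N = go {n} {N} {f} (ℕₚ.≤⇒≤′ n≤N)
    where
    go : ∀ {n N} {f : ℕ → Carrier} → n ≤′ N → (∀ k → n < k → k ≤ N → f k ≈ 0#) →
         ∑≤ N f ≈ ∑≤ n f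
    go ≤′-refl _ = refl
    go {n} {suc N} {f} (≤′-step n≤N) f≈0 = begin
      ∑≤ (suc N) f        ≈⟨ ∑-last N f ⟩
      ∑≤ N f + f (suc N)  ≈⟨ +-cong (go {n} {N} {f} n≤N (λ k n<k k≤N → f≈0 k n<k (ℕₚ.m≤n⇒m≤1+n k≤N)))
                                    (f≈0 (suc N) (s≤s (ℕₚ.≤′⇒≤ n≤N)) ℕₚ.≤-refl) ⟩
      ∑≤ n f + 0#         ≈⟨ +-identityʳ _ ⟩
      ∑≤ n f              ∎

  -- Power series

  ⊛-cong : ∀ {f f′ g g′} → f ≋ f′ → g ≋ g′ → f ⊛ g ≋ f′ ⊛ g′
  ⊛-cong f≋f′ g≋g′ n = ∑-cong n (λ k _ → *-cong (f≋f′ k) (g≋g′ (n ∸ k)))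

  ⊛-distribʳ : ∀ f g h → (f ⊕ g) ⊛ h ≋ f ⊛ h ⊕ g ⊛ h
  ⊛-distribʳ f g h n = trans
    (∑-cong n (λ k _ → distribʳ (h (n ∸ k)) (f k) (g k)))
    (∑-+ n (λ k → f k * h (n ∸ k)) (λ k → g k * h (n ∸ k)))

  ∙-⊛ : ∀ a f g → (a ∙ f) ⊛ g ≋ a ∙ (f ⊛ g)
  ∙-⊛ a f g n = trans
    (∑-cong n (λ k _ → *-assoc a (f k) (g (n ∸ k))))
    (sym (*-∑ n a (λ k → f k * g (n ∸ k))))

  -- The coefficients of f ⊛ g unfold by definition at the first factor; this is
  -- the same step at the second one.
  ⊛-sucʳ : ∀ f g n → (f ⊛ g) (suc n) ≈ (f ⊛ (g /𝕥)) n + f (suc n) * g 0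
  ⊛-sucʳ f g zero    = trans (sym (+-assoc _ _ _)) (trans (+-identityʳ _) (+-congʳ (sym (+-identityʳ _))))
  ⊛-sucʳ f g (suc n) = trans (+-congˡ (⊛-sucʳ (f /𝕥) g n)) (sym (+-assoc _ _ _))

  ⊛-comm : ∀ f g → f ⊛ g ≋ g ⊛ f
  ⊛-comm f g zero    = +-congʳ (*-comm _ _)
  ⊛-comm f g (suc n) = begin
    f 0 * g (suc n) + ((f /𝕥) ⊛ g) n   ≈⟨ +-cong (*-comm _ _) (⊛-comm (f /𝕥) g n) ⟩
    g (suc n) * f 0 + (g ⊛ (f /𝕥)) n   ≈⟨ +-comm _ _ ⟩
    (g ⊛ (f /𝕥)) n + g (suc n) * f 0   ≈⟨ ⊛-sucʳ g f n ⟨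
    (g ⊛ f) (suc n)                    ∎

  ⊛-assoc : ∀ f g h → (f ⊛ g) ⊛ h ≋ f ⊛ (g ⊛ h)
  ⊛-assoc f g h zero = solve 3 (λ a b c →
    (a :* b :+ con 0) :* c :+ con 0 := a :* (b :* c :+ con 0) :+ con 0) refl (f 0) (g 0) (h 0)
  ⊛-assoc f g h (suc n) = begin
    (f ⊛ g) 0 * h (suc n) + ((f 0 ∙ (g /𝕥) ⊕ (f /𝕥) ⊛ g) ⊛ h) n
      ≈⟨ +-congˡ (⊛-distribʳ (f 0 ∙ (g /𝕥)) ((f /𝕥) ⊛ g) h n) ⟩
    (f ⊛ g) 0 * h (suc n) + (((f 0 ∙ (g /𝕥)) ⊛ h) n + (((f /𝕥) ⊛ g) ⊛ h) n)
      ≈⟨ +-congˡ (+-cong (∙-⊛ (f 0) (g /𝕥) h n) (⊛-assoc (f /𝕥) g h n)) ⟩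
    (f 0 * g 0 + 0#) * h (suc n) + (f 0 * ((g /𝕥) ⊛ h) n + ((f /𝕥) ⊛ (g ⊛ h)) n)
      ≈⟨ solve 5 (λ a b c d e → (a :* b :+ con 0) :* c :+ (a :* d :+ e) := a :* (b :* c :+ d) :+ e)
           refl (f 0) (g 0) (h (suc n)) _ _ ⟩
    f 0 * (g ⊛ h) (suc n) + ((f /𝕥) ⊛ (g ⊛ h)) n ∎

  e^-+ : ∀ x y → e^[ x t] ⊛ e^[ y t] ≋ e^[ x + y t]
  e^-+ x y n = begin
    ∑[ k ≤ n ] (x ^ k * invFact k * (y ^ (n ∸ k) * invFact (n ∸ k)))
      ≈⟨ ∑-cong n term ⟩
    ∑[ k ≤ n ] (invFact n * ((n C k) × (x ^ k * y ^ (n ∸ k))))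
      ≈⟨ *-∑ n (invFact n) (λ k → (n C k) × (x ^ k * y ^ (n ∸ k))) ⟨
    invFact n * ∑[ k ≤ n ] ((n C k) × (x ^ k * y ^ (n ∸ k)))
      ≈⟨ *-comm _ _ ⟩
    ∑[ k ≤ n ] ((n C k) × (x ^ k * y ^ (n ∸ k))) * invFact n
      ≈⟨ *-congʳ (Binomial.theorem commutativeSemiring n x y) ⟨
    (x + y) ^ n * invFact n ∎
    where
    term : ∀ k → k ≤ n → x ^ k * invFact k * (y ^ (n ∸ k) * invFact (n ∸ k)) ≈
                         invFact n * ((n C k) × (x ^ k * y ^ (n ∸ k)))
    term k k≤n = begin
      x ^ k * invFact k * (y ^ (n ∸ k) * invFact (n ∸ k))
        ≈⟨ solve 4 (λ a b c d → a :* b :* (c :* d) := b :* d :* (a :* c)) refl _ _ _ _ ⟩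
      invFact k * invFact (n ∸ k) * (x ^ k * y ^ (n ∸ k))
        ≈⟨ *-congʳ (invFact-binomial k≤n) ⟩
      invFact n * ι (n C k) * (x ^ k * y ^ (n ∸ k))
        ≈⟨ *-assoc _ _ _ ⟩
      invFact n * (ι (n C k) * (x ^ k * y ^ (n ∸ k)))
        ≈⟨ *-congˡ (trans (×-assoc-* (n C k) 1# _) (×-congʳ (n C k) (*-identityˡ _))) ⟩
      invFact n * ((n C k) × (x ^ k * y ^ (n ∸ k))) ∎

  -- The alternating sum

  -- The binomial transform of a sequence.
  transform : Series → Series
  transform a j = ∑[ k ≤ j ] (ι (j C k) * a k)

  transform-suc : ∀ a j → transform a (suc j) ≈ transform a j + transform (a /𝕥) j
  transform-suc a j = begin
    ι 1 * a 0 + ∑[ k ≤ j ] (ι (suc j C suc k) * a (suc k))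
      ≈⟨ +-congˡ (∑-cong j (λ k _ → pascal k)) ⟩
    ι 1 * a 0 + ∑[ k ≤ j ] (ι (j C k) * a (suc k) + ι (j C suc k) * a (suc k))
      ≈⟨ +-congˡ (∑-+ j (λ k → ι (j C k) * a (suc k)) (λ k → ι (j C suc k) * a (suc k))) ⟩
    ι 1 * a 0 + (transform (a /𝕥) j + ∑[ k ≤ j ] (ι (j C suc k) * a (suc k)))
      ≈⟨ solve 3 (λ p q r → p :+ (q :+ r) := (p :+ r) :+ q) refl _ _ _ ⟩
    ∑[ k ≤ suc j ] (ι (j C k) * a k) + transform (a /𝕥) j
      ≈⟨ +-congʳ (∑-truncate (ℕₚ.n≤1+n j) λ k j<k _ → C-vanishes k j<k) ⟩
    transform a j + transform (a /𝕥) j ∎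
    where
    pascal : ∀ k → ι (suc j C suc k) * a (suc k) ≈
                   ι (j C k) * a (suc k) + ι (j C suc k) * a (suc k)
    pascal k = trans (*-congʳ (trans (ι-cong (≡.sym (nCk+nC[k+1]≡[n+1]C[k+1] j k))) (ι-+ (j C k) _)))
                     (distribʳ _ _ _)
    C-vanishes : ∀ k → j < k → ι (j C k) * a k ≈ 0#
    C-vanishes k j<k = trans (*-congʳ (ι-cong (k>n⇒nCk≡0 j<k))) (zeroˡ _)

  transform-cong : ∀ {a b} → a ≋ b → transform a ≋ transform b
  transform-cong a≋b j = ∑-cong j (λ k _ → *-congˡ {ι (j C k)} (a≋b k))

  transform-∙ : ∀ s a → transform (s ∙ a) ≋ s ∙ transform a
  transform-∙ s a j = trans
    (∑-cong j (λ k _ → solve 3 (λ p q r → p :* (q :* r) := q :* (p :* r)) refl (ι (j C k)) s (a k)))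
    (sym (*-∑ j s (λ k → ι (j C k) * a k)))

  -- The sequence (-1)ᵏ ω m n k.
  alternating-ω : ℕ → ℕ → Series
  alternating-ω m n k = (- 1#) ^ k * ι (ω m n k)

  transform-ω : ∀ m n j → transform (alternating-ω m n) j ≈
                ι (ω n m j) + (- 1#) ^ m * ι (n ! ℕ.* m ! ℕ.* excess n m j)
  transform-ω m n zero = begin
    ι 1 * (1# * ι ((n ℕ.+ m) !)) + 0#
      ≈⟨ solve 1 (λ a → (con 1 :+ con 0) :* (con 1 :* a) :+ con 0 := a) refl _ ⟩
    ι ((n ℕ.+ m) !)
      ≈⟨ ι-cong (≡.cong _! (ℕₚ.+-comm n m)) ⟩
    ι ((m ℕ.+ n) !)
      ≈⟨ trans (+-congˡ (trans (*-congˡ (ι-cong (ℕₚ.*-zeroʳ (n ! ℕ.* m !)))) (zeroʳ _))) (+-identityʳ _) ⟨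
    ι ((m ℕ.+ n) !) + (- 1#) ^ m * ι (n ! ℕ.* m ! ℕ.* 0) ∎
  transform-ω zero n (suc j) = begin
    ι 1 * (1# * ι ((n ℕ.+ 0) !)) + ∑[ k ≤ j ] (ι (suc j C suc k) * ((- 1#) ^ suc k * 0#))
      ≈⟨ +-congˡ (∑-zero j (λ k _ → trans (*-congˡ {ι (suc j C suc k)} (zeroʳ ((- 1#) ^ suc k))) (zeroʳ _))) ⟩
    ι 1 * (1# * ι ((n ℕ.+ 0) !)) + 0#
      ≈⟨ solve 1 (λ a → (con 1 :+ con 0) :* (con 1 :* a) :+ con 0 := a) refl _ ⟩
    ι ((n ℕ.+ 0) !)
      ≈⟨ ι-cong n!≡ ⟩
    ι (ω n 0 (suc j) ℕ.+ n ! ℕ.* 1 ℕ.* excess n 0 (suc j))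
      ≈⟨ trans (ι-+ (ω n 0 (suc j)) _) (+-congˡ (sym (*-identityˡ _))) ⟩
    ι (ω n 0 (suc j)) + 1# * ι (n ! ℕ.* 1 ℕ.* excess n 0 (suc j)) ∎
    where
    n!≡ : (n ℕ.+ 0) ! ≡ ω n 0 (suc j) ℕ.+ n ! ℕ.* 1 ℕ.* excess n 0 (suc j)
    n!≡ rewrite ℕₚ.+-identityʳ n | ℕₚ.*-identityʳ (n !) = ≡.sym (ω-excess-0 n (suc j))
  transform-ω (suc m) n (suc j) = begin
    transform (alternating-ω (suc m) n) (suc j)
      ≈⟨ transform-suc (alternating-ω (suc m) n) j ⟩
    transform (alternating-ω (suc m) n) j + transform (alternating-ω (suc m) n /𝕥) j
      ≈⟨ +-congˡ (trans (transform-cong shift j) (transform-∙ (u * M) (alternating-ω m n) j)) ⟩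
    transform (alternating-ω (suc m) n) j + u * M * transform (alternating-ω m n) j
      ≈⟨ +-cong (transform-ω (suc m) n j) (*-congˡ (transform-ω m n j)) ⟩
    ι (ω n (suc m) j) + u * s * ι (n ! ℕ.* suc m ! ℕ.* excess n (suc m) j)
      + u * M * (ι (ω n m j) + s * ι (n ! ℕ.* m ! ℕ.* excess n m j))
      ≈⟨ +-cong (+-cong ω≈ (*-congˡ (ι-factor (excess n (suc m) j))))
                (*-congˡ (+-congˡ (*-congˡ (ι-* (n ! ℕ.* m !) _)))) ⟩
    W + M * w + u * s * (M * F * E₁) + u * M * (w + s * (F * E₀))
      ≈⟨ solve 8 (λ u s M F W w E₁ E₀ →
           W :+ M :* w :+ u :* s :* (M :* F :* E₁) :+ u :* M :* (w :+ s :* (F :* E₀)) :=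
           W :+ u :* s :* (M :* F :* (E₁ :+ E₀)) :+ (con 1 :+ u) :* (M :* w))
           refl u s M F W w E₁ E₀ ⟩
    W + u * s * (M * F * (E₁ + E₀)) + (1# + u) * (M * w)
      -- The two occurrences of M * w cancel because u = - 1#.
      ≈⟨ trans (+-congˡ (trans (*-congʳ (-‿inverseʳ 1#)) (zeroˡ _))) (+-identityʳ _) ⟩
    W + u * s * (M * F * (E₁ + E₀))
      ≈⟨ +-congˡ (*-congˡ (*-congˡ
           (trans (sym (ι-+ (excess n (suc m) j) _)) (ι-cong (≡.sym (excess-pascal n m j)))))) ⟩
    W + u * s * (M * F * ι (excess n (suc m) (suc j)))
      ≈⟨ +-congˡ (*-congˡ (ι-factor (excess n (suc m) (suc j)))) ⟨
    W + u * s * ι (n ! ℕ.* suc m ! ℕ.* excess n (suc m) (suc j)) ∎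
    where
    u  = - 1#
    s  = u ^ m
    M  = ι (suc m)
    F  = ι (n ! ℕ.* m !)
    W  = ι (ω n (suc m) (suc j))
    w  = ι (ω n m j)
    E₁ = ι (excess n (suc m) j)
    E₀ = ι (excess n m j)
    shift : alternating-ω (suc m) n /𝕥 ≋ (u * M) ∙ alternating-ω m n
    shift k = trans (*-congˡ (ι-* (suc m) (ω m n k)))
      (solve 4 (λ u a M w → u :* a :* (M :* w) := u :* M :* (a :* w)) refl u (u ^ k) M (ι (ω m n k)))
    ω≈ : ι (ω n (suc m) j) ≈ W + M * w
    ω≈ = trans (ι-cong (ω-pascal n m j))
               (trans (ι-+ (ω n (suc m) (suc j)) _) (+-congˡ (ι-* (suc m) (ω n m j))))
    ι-factor : ∀ e → ι (n ! ℕ.* suc m ! ℕ.* e) ≈ M * F * ι e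
    ι-factor e = trans (ι-cong (regroup (n !) (suc m) (m !) e))
                       (trans (ι-* (suc m ℕ.* (n ! ℕ.* m !)) e) (*-congʳ (ι-* (suc m) (n ! ℕ.* m !))))
      where
      regroup : ∀ a b c d → a ℕ.* (b ℕ.* c) ℕ.* d ≡ b ℕ.* (a ℕ.* c) ℕ.* d
      regroup = solve-∀


  -- The coefficients of the two sums

  ω-coefficient : ∀ m n k z →
    ι ((n ℕ.+ m ∸ k) !) * ι (m C k) * z ≈ ι (ω m n k) * (z * invFact k)
  ω-coefficient m n k z = begin
    a * b * z
      ≈⟨ *-identityʳ _ ⟨
    a * b * z * 1#
      ≈⟨ *-congˡ (!*invFact k) ⟨
    a * b * z * (ι (k !) * invFact k)
      ≈⟨ solve 5 (λ a b z k! k!⁻¹ → a :* b :* z :* (k! :* k!⁻¹) := a :* (b :* k!) :* (z :* k!⁻¹))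
           refl a b z (ι (k !)) (invFact k) ⟩
    a * (b * ι (k !)) * (z * invFact k)
      ≈⟨ *-congʳ (trans (ι-cong (ω-closed m n k))
                        (trans (ι-* ((n ℕ.+ m ∸ k) !) _) (*-congˡ (ι-* (m C k) (k !))))) ⟨
    ι (ω m n k) * (z * invFact k) ∎
    where
    a = ι ((n ℕ.+ m ∸ k) !)
    b = ι (m C k)

  -- The series A, B and D: the factors by which the sum over k ≤ n weights fₚ₋ₖ,
  -- those of the sum over k ≤ m, and the series giving the additional sum.
  left right correction : ℕ → ℕ → Carrier → Series
  left       m n y k = ι ((n ℕ.+ m ∸ k) !) * ι (n C k) * y ^ k
  right      m n y k = ι ((n ℕ.+ m ∸ k) !) * ι (m C k) * (- y) ^ k
  correction m n y k = (- 1#) ^ m * ι (n ! ℕ.* m ! ℕ.* excess n m k) * (y ^ k * invFact k)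

  right-shifted : ∀ m n y → right m n y ⊛ e^[ y t] ≋ left m n y ⊕ correction m n y
  right-shifted m n y j = begin
    ∑[ k ≤ j ] (right m n y k * (y ^ (j ∸ k) * invFact (j ∸ k)))
      ≈⟨ ∑-cong j term ⟩
    ∑[ k ≤ j ] (y ^ j * invFact j * (ι (j C k) * alternating-ω m n k))
      ≈⟨ *-∑ j (y ^ j * invFact j) (λ k → ι (j C k) * alternating-ω m n k) ⟨
    y ^ j * invFact j * transform (alternating-ω m n) j
      ≈⟨ *-congˡ (transform-ω m n j) ⟩
    y ^ j * invFact j * (ι (ω n m j) + (- 1#) ^ m * ι (n ! ℕ.* m ! ℕ.* excess n m j))
      ≈⟨ trans (*-comm _ _) (distribʳ _ _ _) ⟩
    ι (ω n m j) * (y ^ j * invFact j) + correction m n y j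
      ≈⟨ +-congʳ (ω-coefficient n m j (y ^ j)) ⟨
    ι ((m ℕ.+ n ∸ j) !) * ι (n C j) * y ^ j + correction m n y j
      ≈⟨ +-congʳ (*-congʳ (*-congʳ (ι-cong (≡.cong (λ s → (s ∸ j) !) (ℕₚ.+-comm m n))))) ⟩
    left m n y j + correction m n y j ∎
    where
    power-neg : ∀ k → (- y) ^ k ≈ (- 1#) ^ k * y ^ k
    power-neg k = trans (^-congˡ k (sym (-1*x≈-x y))) (^-distrib-* (- 1#) y k)

    power-split : ∀ {k} → k ≤ j → y ^ k * y ^ (j ∸ k) ≈ y ^ j
    power-split {k} k≤j =
      trans (sym (^-homo-* y k (j ∸ k))) (reflexive (≡.cong (y ^_) (ℕₚ.m+[n∸m]≡n k≤j)))

    term : ∀ k → k ≤ j → right m n y k * (y ^ (j ∸ k) * invFact (j ∸ k)) ≈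
                         y ^ j * invFact j * (ι (j C k) * alternating-ω m n k)
    term k k≤j = begin
      right m n y k * (y ^ (j ∸ k) * invFact (j ∸ k))
        ≈⟨ *-congʳ (trans (ω-coefficient m n k ((- y) ^ k)) (*-congˡ (*-congʳ (power-neg k)))) ⟩
      ι (ω m n k) * ((- 1#) ^ k * y ^ k * invFact k) * (y ^ (j ∸ k) * invFact (j ∸ k))
        ≈⟨ solve 6 (λ w s a b c d → w :* (s :* a :* b) :* (c :* d) := (a :* c) :* (b :* d) :* (s :* w))
             refl (ι (ω m n k)) ((- 1#) ^ k) (y ^ k) (invFact k) (y ^ (j ∸ k)) (invFact (j ∸ k)) ⟩
      (y ^ k * y ^ (j ∸ k)) * (invFact k * invFact (j ∸ k)) * alternating-ω m n k
        ≈⟨ *-congʳ (*-cong (power-split k≤j) (invFact-binomial k≤j)) ⟩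
      y ^ j * (invFact j * ι (j C k)) * alternating-ω m n k
        ≈⟨ solve 4 (λ a b c d → a :* (b :* c) :* d := a :* b :* (c :* d))
             refl (y ^ j) (invFact j) (ι (j C k)) (alternating-ω m n k) ⟩
      y ^ j * invFact j * (ι (j C k) * alternating-ω m n k) ∎

  -- A sum with a fixed bound N, taken against the coefficients of f extended by
  -- zero to negative indices, is a coefficient of a product of series: for p < N
  -- the surplus terms have a negative index, and for N < p the missing terms
  -- have a k = 0.
  ∑-⊛ : ∀ (a f : Series) (h : ℤ → Carrier) →
        (∀ k → h (+ k) ≈ f k) → (∀ k → h -[1+ k ] ≈ 0#) →
        ∀ N p → (∀ k → N < k → a k ≈ 0#) →
        ∑[ k ≤ N ] (a k * h (p ⊖ k)) ≈ (a ⊛ f) p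
  ∑-⊛ a f h h-pos h-neg zero    zero    a-big = +-congʳ (*-congˡ (h-pos 0))
  ∑-⊛ a f h h-pos h-neg zero    (suc p) a-big =
    +-cong (*-congˡ (h-pos (suc p)))
           (sym (∑-zero p (λ k _ → trans (*-congʳ {f (p ∸ k)} (a-big (suc k) (s≤s z≤n))) (zeroˡ _))))
  ∑-⊛ a f h h-pos h-neg (suc N) zero    a-big =
    +-cong (*-congˡ (h-pos 0))
           (∑-zero N (λ k _ → trans (*-congˡ {a (suc k)} (h-neg k)) (zeroʳ _)))
  ∑-⊛ a f h h-pos h-neg (suc N) (suc p) a-big = +-cong (*-congˡ (h-pos (suc p))) (trans
    (∑-cong N (λ k _ → *-congˡ {a (suc k)} (reflexive (≡.cong h ([1+m]⊖[1+n]≡m⊖n p k)))))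
    (∑-⊛ (a /𝕥) f h h-pos h-neg N p (λ k N<k → a-big (suc k) (s≤s N<k))))

  -- Sums of Apostol-type polynomials as coefficients of products

  module _ (F : Family) {ƛ : Carrier} (α : Order F ƛ) where

    -- The coefficient of t^z in the generating function at x, which is 0 for
    -- negative z.
    coefficient : Carrier → ℤ → Carrier
    coefficient x z = invFactℤ z * Λ F α z x

    coefficient-pos : ∀ x k → coefficient x (+ k) ≈ generatingFunction α x k
    coefficient-pos x k = begin
      invFact k * (ι (k !) * g)   ≈⟨ solve 3 (λ a b c → a :* (b :* c) := b :* a :* c)
                                       refl (invFact k) (ι (k !)) g ⟩
      ι (k !) * invFact k * g     ≈⟨ *-congʳ (!*invFact k) ⟩
      1# * g                      ≈⟨ *-identityˡ g ⟩
      g                           ∎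
      where g = generatingFunction α x k

    coefficient-neg : ∀ x k → coefficient x -[1+ k ] ≈ 0#
    coefficient-neg x k = zeroˡ _

    generatingFunction-+ : ∀ x y →
      generatingFunction α (x + y) ≋ e^[ y t] ⊛ generatingFunction α x
    generatingFunction-+ x y k = begin
      (P ⊛ e^[ x + y t]) k             ≈⟨ ⊛-cong {P} (λ _ → refl) (e^-+ x y) k ⟨
      (P ⊛ (e^[ x t] ⊛ e^[ y t])) k    ≈⟨ ⊛-assoc P e^[ x t] e^[ y t] k ⟨
      ((P ⊛ e^[ x t]) ⊛ e^[ y t]) k    ≈⟨ ⊛-comm (P ⊛ e^[ x t]) e^[ y t] k ⟩
      (e^[ y t] ⊛ (P ⊛ e^[ x t])) k    ∎
      where P = prefactor α

    module _ (m n p : ℕ) (x y : Carrier) where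

      f : Series
      f = generatingFunction α x

      leftSum : ∑[ k ≤ n ] (ι ((n ℕ.+ m ∸ k) !) * invFactℤ (p ⊖ k) * ι (n C k) * y ^ k * Λ F α (p ⊖ k) x)
                ≈ (left m n y ⊛ f) p
      leftSum = trans (∑-cong n (λ k _ → regroup k))
        (∑-⊛ (left m n y) f (coefficient x) (coefficient-pos x) (coefficient-neg x) n p vanish)
        where
        regroup : ∀ k →
          ι ((n ℕ.+ m ∸ k) !) * invFactℤ (p ⊖ k) * ι (n C k) * y ^ k * Λ F α (p ⊖ k) x
          ≈ left m n y k * coefficient x (p ⊖ k)
        regroup k = solve 5 (λ a b c d e → a :* b :* c :* d :* e := a :* c :* d :* (b :* e)) refl
          (ι ((n ℕ.+ m ∸ k) !)) (invFactℤ (p ⊖ k)) (ι (n C k)) (y ^ k) (Λ F α (p ⊖ k) x)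
        vanish : ∀ k → n < k → left m n y k ≈ 0#
        vanish k n<k =
          trans (*-congʳ (trans (*-congˡ (ι-cong (k>n⇒nCk≡0 n<k))) (zeroʳ _))) (zeroˡ _)

      rightSum : ∑[ k ≤ m ] ((- y) ^ k * ι ((n ℕ.+ m ∸ k) !) * invFactℤ (p ⊖ k) * ι (m C k) * Λ F α (p ⊖ k) (x + y))
                 ≈ (left m n y ⊛ f) p + (correction m n y ⊛ f) p
      rightSum = begin
        ∑[ k ≤ m ] ((- y) ^ k * ι ((n ℕ.+ m ∸ k) !) * invFactℤ (p ⊖ k) * ι (m C k) * Λ F α (p ⊖ k) (x + y))
          ≈⟨ ∑-cong m (λ k _ → regroup k) ⟩
        ∑[ k ≤ m ] (right m n y k * coefficient (x + y) (p ⊖ k))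
          ≈⟨ ∑-⊛ (right m n y) _ (coefficient (x + y))
               (coefficient-pos (x + y)) (coefficient-neg (x + y)) m p vanish ⟩
        (right m n y ⊛ generatingFunction α (x + y)) p
          ≈⟨ ⊛-cong {right m n y} (λ _ → refl) (generatingFunction-+ x y) p ⟩
        (right m n y ⊛ (e^[ y t] ⊛ f)) p
          ≈⟨ ⊛-assoc (right m n y) e^[ y t] f p ⟨
        ((right m n y ⊛ e^[ y t]) ⊛ f) p
          ≈⟨ ⊛-cong {g = f} (right-shifted m n y) (λ _ → refl) p ⟩
        ((left m n y ⊕ correction m n y) ⊛ f) p
          ≈⟨ ⊛-distribʳ (left m n y) (correction m n y) f p ⟩
        (left m n y ⊛ f) p + (correction m n y ⊛ f) p ∎
        where
        regroup : ∀ k →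
          (- y) ^ k * ι ((n ℕ.+ m ∸ k) !) * invFactℤ (p ⊖ k) * ι (m C k) * Λ F α (p ⊖ k) (x + y)
          ≈ right m n y k * coefficient (x + y) (p ⊖ k)
        regroup k = solve 5 (λ a b c d e → d :* a :* b :* c :* e := a :* c :* d :* (b :* e)) refl
          (ι ((n ℕ.+ m ∸ k) !)) (invFactℤ (p ⊖ k)) (ι (m C k)) ((- y) ^ k) (Λ F α (p ⊖ k) (x + y))
        vanish : ∀ k → m < k → right m n y k ≈ 0#
        vanish k m<k =
          trans (*-congʳ (trans (*-congˡ (ι-cong (k>n⇒nCk≡0 m<k))) (zeroʳ _))) (zeroˡ _)

      correction-small : ∀ {j} → j ≤ m ℕ.+ n → correction m n y j ≈ 0#
      correction-small {j} j≤m+n = trans (*-congʳ (trans (*-congˡ (ι-cong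
        (≡.trans (≡.cong (n ! ℕ.* m ! ℕ.*_) (excess-small n m j≤m+n)) (ℕₚ.*-zeroʳ (n ! ℕ.* m !)))))
        (zeroʳ _))) (zeroˡ _)

      correctionSum-small : p ≤ m ℕ.+ n → (correction m n y ⊛ f) p ≈ 0#
      correctionSum-small p≤m+n = ∑-zero p (λ k k≤p → trans
        (*-congʳ {f (p ∸ k)} (correction-small (ℕₚ.≤-trans k≤p p≤m+n))) (zeroˡ _))

      correctionSum-large : m ℕ.+ n ℕ.+ 1 ≤ p →
        (correction m n y ⊛ f) p ≈
        (- 1#) ^ m * (ι (n ! ℕ.* m !) * invFactℤ (+ p))
          * ∑[ k ≤ p ∸ m ∸ n ∸ 1 ] (y ^ (p ∸ k) * ι (p C k) * ι ((p ∸ k ∸ n ∸ 1) C m) * Λ F α (+ k) x)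
      correctionSum-large m+n<p = begin
        (correction m n y ⊛ f) p
          ≈⟨ ⊛-comm (correction m n y) f p ⟩
        ∑[ k ≤ p ] (f k * correction m n y (p ∸ k))
          ≈⟨ ∑-truncate {f = λ k → f k * correction m n y (p ∸ k)} q≤p vanish ⟩
        ∑[ k ≤ q ] (f k * correction m n y (p ∸ k))
          ≈⟨ ∑-cong q term ⟩
        ∑[ k ≤ q ] (C₀ * (y ^ (p ∸ k) * ι (p C k) * ι ((p ∸ k ∸ n ∸ 1) C m) * Λ F α (+ k) x))
          ≈⟨ *-∑ q C₀ (λ k → y ^ (p ∸ k) * ι (p C k) * ι ((p ∸ k ∸ n ∸ 1) C m) * Λ F α (+ k) x) ⟨
        C₀ * ∑[ k ≤ q ] (y ^ (p ∸ k) * ι (p C k) * ι ((p ∸ k ∸ n ∸ 1) C m) * Λ F α (+ k) x) ∎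
        where
        q = p ∸ m ∸ n ∸ 1
        C₀ = (- 1#) ^ m * (ι (n ! ℕ.* m !) * invFact p)

        q≤p : q ≤ p
        q≤p = ≡.subst (_≤ p) (≡.sym (∸-gather p m n)) (ℕₚ.m∸n≤m p (m ℕ.+ n ℕ.+ 1))

        vanish : ∀ k → q < k → k ≤ p → f k * correction m n y (p ∸ k) ≈ 0#
        vanish k q<k _ = trans (*-congˡ (correction-small (gap-small p m n q<k))) (zeroʳ _)

        invFact-∸ : ∀ {k} → k ≤ p → invFact (p ∸ k) ≈ invFact p * ι (p C k) * ι (k !)
        invFact-∸ {k} k≤p = begin
          invFact (p ∸ k)                          ≈⟨ *-identityˡ _ ⟨
          1# * invFact (p ∸ k)                     ≈⟨ *-congʳ (!*invFact k) ⟨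
          ι (k !) * invFact k * invFact (p ∸ k)    ≈⟨ *-assoc _ _ _ ⟩
          ι (k !) * (invFact k * invFact (p ∸ k))  ≈⟨ *-congˡ (invFact-binomial k≤p) ⟩
          ι (k !) * (invFact p * ι (p C k))        ≈⟨ *-comm _ _ ⟩
          invFact p * ι (p C k) * ι (k !)          ∎

        term : ∀ k → k ≤ q → f k * correction m n y (p ∸ k) ≈
               C₀ * (y ^ (p ∸ k) * ι (p C k) * ι ((p ∸ k ∸ n ∸ 1) C m) * Λ F α (+ k) x)
        term k k≤q = begin
          f k * (s * ι (n ! ℕ.* m ! ℕ.* excess n m (p ∸ k)) * (Y * invFact (p ∸ k)))
            ≈⟨ *-congˡ (*-cong
                 (*-congˡ (trans (ι-* (n ! ℕ.* m !) _) (*-congˡ (ι-cong (excess-large n m (gap-large p m n m+n<p k≤q))))))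
                 (*-congˡ (invFact-∸ (ℕₚ.≤-trans k≤q q≤p)))) ⟩
          f k * (s * (N * E) * (Y * (invFact p * ι (p C k) * ι (k !))))
            ≈⟨ solve 8 (λ f s N E Y i c k! →
                 f :* (s :* (N :* E) :* (Y :* (i :* c :* k!))) :=
                 s :* (N :* i) :* (Y :* c :* E :* (k! :* f)))
                 refl (f k) s N E Y (invFact p) (ι (p C k)) (ι (k !)) ⟩
          C₀ * (Y * ι (p C k) * E * Λ F α (+ k) x) ∎
          where
          s = (- 1#) ^ m
          N = ι (n ! ℕ.* m !)
          E = ι ((p ∸ k ∸ n ∸ 1) C m)
          Y = y ^ (p ∸ k)

theorem1 : ∀ {c ℓ₁ ℓ₂} (K : ExponentialField c ℓ₁ ℓ₂) → let open Apostol K in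
    (F : Family) (ƛ : Carrier) (α : Order F ƛ) (m n p : ℕ) (x y : Carrier) →
    (p ≤ m ℕ.+ n →
    ∑[ k ≤ n ] (ι ((n ℕ.+ m ∸ k) !) * invFactℤ (p ⊖ k) * ι (n C k) * y ^ k * Λ F α (p ⊖ k) x)
    ≈ ∑[ k ≤ m ] ((- y) ^ k * ι ((n ℕ.+ m ∸ k) !) * invFactℤ (p ⊖ k) * ι (m C k) * Λ F α (p ⊖ k) (x + y)))
    ∧
    (m ℕ.+ n ℕ.+ 1 ≤ p →
    ∑[ k ≤ n ] (ι ((n ℕ.+ m ∸ k) !) * invFactℤ (p ⊖ k) * ι (n C k) * y ^ k * Λ F α (p ⊖ k) x)
    ≈ ∑[ k ≤ m ] ((- y) ^ k * ι ((n ℕ.+ m ∸ k) !) * invFactℤ (p ⊖ k) * ι (m C k) * Λ F α (p ⊖ k) (x + y))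
    - (- 1#) ^ m * (ι (n ! ℕ.* m !) * invFactℤ (+ p))
    * ∑[ k ≤ p ∸ m ∸ n ∸ 1 ] (y ^ (p ∸ k) * ι (p C k) * ι ((p ∸ k ∸ n ∸ 1) C m) * Λ F α (+ k) x))
theorem1 K F ƛ α m n p x y = small , large
  where
  open ExponentialField K
    using (sym; trans; +-cong; +-congˡ; +-assoc; +-identityʳ; -‿cong; -‿inverseʳ)
  small = λ p≤m+n → trans (leftSum K F α m n p x y) (sym (trans (rightSum K F α m n p x y)
    (trans (+-congˡ (correctionSum-small K F α m n p x y p≤m+n)) (+-identityʳ _))))
  large = λ m+n<p → trans (leftSum K F α m n p x y) (sym (trans
    (+-cong (rightSum K F α m n p x y)
            (-‿cong (sym (correctionSum-large K F α m n p x y m+n<p))))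
    (trans (+-assoc _ _ _) (trans (+-congˡ (-‿inverseʳ _)) (+-identityʳ _)))))
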